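{- Let $k\ge 1$ and $n\ge 1$ be integers and let $\lambda$ be a partition. The number of large $(k,k)$-Fuss-Schröder paths of length $n$ and type $\lambda$ is \[ \frac{1}{n}\left(\binom{n}{|\lambda|+1}+\frac{|\lambda|}{kn+1}\binom{n+1}{|\lambda|+1}\right)\binom{kn+1}{\ell(\lambda)}\frac{\ell(\lambda)!}{m_\lambda}. \] The number of large $(k,k)$-Fuss-Schröder paths of length $n$ and type $\lambda$ which end in a diagonal step is \[ \frac{1}{n} \binom{n}{|\lambda|+1}\binom{kn}{\ell(\lambda)}\frac{\ell(\lambda)!}{m_\lambda}. \]
   Context: For a partition $\lambda$ (possibly empty), $\ell(\lambda)$ is its number of parts, $|\lambda|$ the sum of its parts, $m_i(\lambda)$ the number of parts equal to $i$, and $m_\lambda=m_1(\lambda)!\,m_2(\lambda)!\,m_3(\lambda)!\cdots$. Binomial coefficients $\binom{a}{b}$ with $b<0$ or $b>a\ge 0$ are $0$. A large $(k,k)$-Fuss-Schröder path of length $n$ is a lattice path from $(0,0)$ to $(n,kn)$ using east steps $(1,0)$, north steps $(0,1)$ and diagonal steps $(1,1)$, which stays nonstrictly above the line $y=kx$, and such that each diagonal step goes from the line $y=kj+k-1$ to the line $y=kj+k$ for some integer $j$. The type of such a path is the partition whose parts are the lengths of the maximal runs of consecutive east steps in the path. -}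

module Defs where

open import Data.Integer.Base using (+_)
open import Data.List.Base using (List; []; _∷_; length; filter; map; upTo)
open import Data.List.Membership.Propositional using (_∈_)
open import Data.List.Relation.Binary.Permutation.Propositional using (_↭_)
open import Data.List.Relation.Unary.All using (All)
open import Data.List.Relation.Unary.All.Properties using (map⁺)
import Data.List.Relation.Unary.All as All
open import Data.List.Relation.Unary.Linked using (Linked)
open import Data.List.Relation.Unary.Unique.Propositional using (Unique)
open import Data.Nat.Base using (ℕ; zero; suc; _+_; _*_; _≤_; _≥_; NonZero; _!)
open import Data.Nat.ListAction using (product; sum)
open import Data.Nat.ListAction.Properties using (product≢0)
open import Data.Nat.Properties using (_≟_; _!≢0)
open import Data.Product.Base using (_×_; _,_; ∃-syntax)
open import Data.Rational.Base using (ℚ; _/_)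
open import Function.Bundles using (_⇔_)
open import Relation.Binary.PropositionalEquality.Core using (_≡_)

record Partition : Set where
  field
    parts      : List ℕ
    positive   : All NonZero parts
    decreasing : Linked _≥_ parts

open Partition public

ℓ : Partition → ℕ
ℓ μ = length (parts μ)

∥_∥ : Partition → ℕ
∥ μ ∥ = sum (parts μ)

mult : ℕ → Partition → ℕ
mult i μ = length (filter (i ≟_) (parts μ))

-- The factors mᵢ(μ)! with i > |μ| of the infinite product, omitted here,
-- equal 0! = 1, as no part exceeds |μ|.
multFactorial : Partition → ℕ
multFactorial μ = product (map (λ i → mult (suc i) μ !) (upTo ∥ μ ∥))

multFactorial≢0 : ∀ μ → NonZero (multFactorial μ)
multFactorial≢0 μ =
  product≢0 (map⁺ (All.universal (λ i → mult (suc i) μ !≢0) (upTo ∥ μ ∥)))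

data Step : Set where
  E N D : Step

-- All steps are nonnegative, so paths from the origin stay in ℕ × ℕ.
Point : Set
Point = ℕ × ℕ

move : Step → Point → Point
move E (x , y) = suc x , y
move N (x , y) = x , suc y
move D (x , y) = suc x , suc y

Above : ℕ → Point → Set
Above k (x , y) = k * x ≤ y

-- A diagonal step starts on y = kj + k - 1; since y ≥ 0 and k ≥ 1, the
-- integer j is necessarily nonnegative.
data Allowed (k : ℕ) : Step → Point → Set where
  east  : ∀ {p} → Allowed k E p
  north : ∀ {p} → Allowed k N p
  diag  : ∀ {x y} (j : ℕ) → suc y ≡ k * j + k → Allowed k D (x , y)

-- Staying above the line is required at lattice points only: each step is a
-- straight segment, so it then holds along the whole path.
data PathFromTo (k : ℕ) : Point → Point → List Step → Set where
  stop : ∀ {p} → Above k p → PathFromTo k p p []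
  step : ∀ {p q s w} → Above k p → Allowed k s p →
         PathFromTo k (move s p) q w → PathFromTo k p q (s ∷ w)

LargePath : (k n : ℕ) → List Step → Set
LargePath k n = PathFromTo k (0 , 0) (n , k * n)

-- Lengths of the maximal runs of east steps, in order, of a word preceded
-- by r further east steps.
eastRunsAfter : (r : ℕ) → List Step → List ℕ
closeRun      : (r : ℕ) → List ℕ → List ℕ

eastRunsAfter r []      = closeRun r []
eastRunsAfter r (E ∷ w) = eastRunsAfter (suc r) w
eastRunsAfter r (N ∷ w) = closeRun r (eastRunsAfter 0 w)
eastRunsAfter r (D ∷ w) = closeRun r (eastRunsAfter 0 w)

closeRun zero    rs = rs
closeRun (suc r) rs = suc r ∷ rs

eastRuns : List Step → List ℕ
eastRuns = eastRunsAfter 0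

HasType : List Step → Partition → Set
HasType w μ = eastRuns w ↭ parts μ

HasCardinality : {A : Set} → (A → Set) → ℕ → Set
HasCardinality {A} P c =
  ∃[ xs ] Unique xs × (∀ (x : A) → x ∈ xs ⇔ P x) × length xs ≡ c

fromℕ : ℕ → ℚ
fromℕ a = + a / 1

{-# OPTIONS --safe #-}

-- A path is cut at the lines y = kn, which diagonal steps enter. Let A(n, d, μ)
-- be the number of paths of type μ with d diagonal steps that end on the line
-- y = kn - 1, and s = |μ|, l = ℓ(μ). As in the ballot theorem of Takács,
--   n m_μ A(n, d, μ) = C(n, d) (n - d - s) kn (kn - 1) ⋯ (kn - l + 1)
-- whenever d + s ≤ n. The induction goes up one line at a time: a path ending
-- on a line with a final run of v east steps extends a path of type μ - v, and
-- since m_μ = m_{μ - v} times the multiplicity of v, the sum over the distinct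
-- v, scaled by m_μ, is a sum over all parts of μ, of an expression affine in v.
-- It therefore depends on μ through s and l only.

module Submission where

open import Defs
open import Data.Empty using (⊥)
open import Data.List.Base using (List; []; _∷_; _++_; _∷ʳ_; _ʳ++_; deduplicate; filter; foldr; last; length; map; replicate; reverse; upTo)
open import Data.List.Membership.Propositional using (_∈_; find; lose)
open import Data.List.Membership.Propositional.Properties using (∈-map⁺; ∈-map⁻; ∈-++⁺ˡ; ∈-++⁺ʳ; ∈-++⁻; ∈-upTo⁺; ∈-∃++; ∈-deduplicate⁺; ∈-deduplicate⁻)
open import Data.List.Properties using (++-cancelˡ; ++-identityʳ; ∷-injectiveʳ; filter-accept; filter-reject; length-++; length-map; reverse-injective; reverse-involutive; unfold-reverse)
open import Data.List.Relation.Binary.Permutation.Propositional using (_↭_; refl; prep; swap; trans; ↭-reflexive; ↭-sym)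
open import Data.List.Relation.Binary.Permutation.Propositional.Properties using (All-resp-↭; drop-∷; filter-↭; shift; ∈-resp-↭; ↭-length)
open import Data.List.Relation.Binary.Subset.Propositional using (_⊆_)
open import Data.List.Relation.Unary.All as All using (All; []; _∷_)
open import Data.List.Relation.Unary.AllPairs using ([]; _∷_)
open import Data.List.Relation.Unary.Any using (Any; here; there)
open import Data.List.Relation.Unary.Unique.Propositional using (Unique)
import Data.List.Relation.Unary.Unique.Propositional.Properties as Unique
open import Data.Maybe.Base using (just)
import Data.Nat.Base as ℕ
open import Data.Nat.Base using (ℕ; suc; NonZero; _!) renaming (_*_ to _*ℕ_)
open import Data.Nat.Combinatorics using (_C_; k>n⇒nCk≡0; nC1≡n; nCk+nC[k+1]≡[n+1]C[k+1]; nCk≡nC[n∸k])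
open import Data.Nat.Divisibility using (_∣_; divides; ∣m+n∣m⇒∣n; ∣⇒≤; m∣m*n)
open import Data.Nat.ListAction using (product; sum)
open import Data.Nat.ListAction.Properties using (sum-↭)
import Data.Nat.Properties as ℕ
open import Data.Product.Base using (_×_; _,_; ∃-syntax; proj₁; proj₂)
open import Data.Sum.Base using (_⊎_; inj₁; inj₂; [_,_]′)
open import Data.Unit using (⊤; tt)
open import Function.Base using (_∘_; id)
open import Function.Bundles using (_⇔_; mk⇔; Equivalence)
open import Function.Construct.Composition using (_⇔-∘_)
open import Function.Construct.Symmetry using (⇔-sym)
open import Relation.Binary.PropositionalEquality as ≡ using (_≡_; _≢_; refl; sym; cong; cong₂; subst; ≢-sym)
open import Relation.Nullary using (¬_; yes; no; contradiction)
open Equivalence using (to; from)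
open ≡.≡-Reasoning

module _ where
  open import Data.List.Relation.Unary.Unique.DecPropositional.Properties ℕ._≟_ using (deduplicate-!)
  open import Data.Nat.Base
  open import Data.Nat.Properties
  open import Data.Nat.Tactic.RingSolver using (solve-∀)
  open import Algebra.Definitions {A = ℕ} _≡_ using (Associative; Commutative)

  -- Finite cardinalities

  private variable
    A B : Set
    P Q : A → Set

  card-cong : ∀ {c} → (∀ x → P x ⇔ Q x) → HasCardinality P c → HasCardinality Q c
  card-cong P⇔Q (xs , uniq , spec , len) = xs , uniq , (λ x → P⇔Q x ⇔-∘ spec x) , len

  card-∅ : (∀ x → ¬ P x) → HasCardinality P 0
  card-∅ ¬P = [] , [] , (λ x → mk⇔ (λ ()) (λ p → contradiction p (¬P x))) , refl

  card-singleton : {a : A} → P a → (∀ x → P x → x ≡ a) → HasCardinality P 1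
  card-singleton {a = a} pa only =
    a ∷ [] , [] ∷ [] , (λ x → mk⇔ (λ { (here refl) → pa }) (λ px → here (only x px))) , refl

  card-⊎ : ∀ {a b} → (∀ {x} → P x → ¬ Q x) → HasCardinality P a → HasCardinality Q b →
           HasCardinality (λ x → P x ⊎ Q x) (a + b)
  card-⊎ {P = P} {Q = Q} disjoint (xs , uxs , P⇔ , refl) (ys , uys , Q⇔ , refl) =
    xs ++ ys ,
    Unique.++⁺ uxs uys (λ (x∈ , y∈) → disjoint (to (P⇔ _) x∈) (to (Q⇔ _) y∈)) ,
    (λ z → mk⇔ ([ inj₁ ∘ to (P⇔ z) , inj₂ ∘ to (Q⇔ z) ]′ ∘ ∈-++⁻ xs)
               [ ∈-++⁺ˡ ∘ from (P⇔ z) , ∈-++⁺ʳ xs ∘ from (Q⇔ z) ]′) ,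
    length-++ xs

  Image : (A → B) → (A → Set) → B → Set
  Image f P y = ∃[ x ] P x × y ≡ f x

  card-image : ∀ {c} {f : A → B} → (∀ {x y} → f x ≡ f y → x ≡ y) →
               HasCardinality P c → HasCardinality (Image f P) c
  card-image {f = f} injective (xs , uniq , P⇔ , refl) =
    map f xs ,
    Unique.map⁺ injective uniq ,
    (λ y → mk⇔ (λ y∈ → let x , x∈ , eq = ∈-map⁻ f y∈ in x , to (P⇔ x) x∈ , eq)
               (λ { (x , px , refl) → ∈-map⁺ f (from (P⇔ x) px) })) ,
    length-map f xs

  -- The closed forms have denominator `n * multFact μ`. Keeping that factor with the count leaves
  -- every identity in the natural numbers, and counts scaled by the same `K` can be added.
  record Counts (P : A → Set) (K z : ℕ) : Set where
    constructor counted
    field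
      {number}    : ℕ
      cardinality : HasCardinality P number
      scaled      : K * number ≡ z

  counts-⊎ : ∀ {K y z} → (∀ {x} → P x → ¬ Q x) → Counts P K y → Counts Q K z →
             Counts (λ x → P x ⊎ Q x) K (y + z)
  counts-⊎ {K = K} disjoint (counted {a} cardP refl) (counted {b} cardQ refl) =
    counted (card-⊎ disjoint cardP cardQ) (*-distribˡ-+ K a b)

  counts-map : ∀ {K z} → (∀ {c} → HasCardinality P c → HasCardinality Q c) →
               Counts P K z → Counts Q K z
  counts-map f (counted card eq) = counted (f card) eq

  counts-∅ : ∀ {K} → (∀ x → ¬ P x) → Counts P K 0
  counts-∅ {K = K} ¬P = counted (card-∅ ¬P) (*-zeroʳ K)

  counts-Any : {I : Set} {R : I → A → Set} {K : ℕ} {f : I → ℕ} →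
               (∀ {u v x} → R u x → R v x → u ≡ v) →
               ∀ {vs} → Unique vs → All (λ v → Counts (R v) K (f v)) vs →
               Counts (λ x → Any (λ v → R v x) vs) K (sum (map f vs))
  counts-Any disjoint [] [] = counts-∅ (λ _ ())
  counts-Any {R = R} disjoint {v ∷ vs} (v≢ ∷ uniq) (count ∷ counts) =
    counts-map (card-cong (λ x → mk⇔ [ here , there ]′ λ { (here r) → inj₁ r ; (there r) → inj₂ r }))
      (counts-⊎ (λ r → apart v≢ r) count (counts-Any disjoint uniq counts))
    where
    apart : ∀ {us x} → All (v ≢_) us → R v x → ¬ Any (λ u → R u x) us
    apart (v≢u ∷ _) r (here r′)  = v≢u (disjoint r r′)
    apart (_ ∷ v≢)  r (there r′) = apart v≢ r r′

  -- Runs of east steps and reversal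

  -- Meant for words read backwards, whose head is the last step of the path.
  NoFinalE : List Step → Set
  NoFinalE []      = ⊤
  NoFinalE (E ∷ _) = ⊥
  NoFinalE (N ∷ _) = ⊤
  NoFinalE (D ∷ _) = ⊤

  eastRunsAfter-NoFinalE : ∀ r w → NoFinalE w → eastRunsAfter r w ≡ closeRun r (eastRuns w)
  eastRunsAfter-NoFinalE r []      _ = refl
  eastRunsAfter-NoFinalE r (N ∷ w) _ = refl
  eastRunsAfter-NoFinalE r (D ∷ w) _ = refl

  eastRunsAfter-replicate : ∀ r v w → eastRunsAfter r (replicate v E ++ w) ≡ eastRunsAfter (v + r) w
  eastRunsAfter-replicate r zero    w = refl
  eastRunsAfter-replicate r (suc v) w =
    ≡.trans (eastRunsAfter-replicate (suc r) v w) (cong (λ t → eastRunsAfter t w) (+-suc v r))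

  eastRuns-replicate : ∀ v w → NoFinalE w →
                       eastRuns (replicate v E ++ w) ≡ closeRun v (eastRuns w)
  eastRuns-replicate v w noE = ≡.trans (eastRunsAfter-replicate 0 v w)
    (≡.trans (cong (λ t → eastRunsAfter t w) (+-identityʳ v)) (eastRunsAfter-NoFinalE v w noE))

  closeRun-++ : ∀ r xs ys → closeRun r (xs ++ ys) ≡ closeRun r xs ++ ys
  closeRun-++ zero    xs ys = refl
  closeRun-++ (suc r) xs ys = refl

  ++-closeRun : ∀ r xs ys → xs ++ closeRun r ys ↭ closeRun r (xs ++ ys)
  ++-closeRun zero    xs ys = refl
  ++-closeRun (suc r) xs ys = shift (suc r) xs ys

  move-run : ∀ w r v → NoFinalE v →
    eastRuns w ++ eastRuns (replicate r E ++ v) ↭ closeRun r (eastRuns w) ++ eastRuns v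
  move-run w r v noE = trans (↭-reflexive (cong (eastRuns w ++_) (eastRuns-replicate r v noE)))
    (trans (++-closeRun r (eastRuns w) (eastRuns v)) (↭-reflexive (closeRun-++ r (eastRuns w) _)))

  -- The steps of `w` move one by one onto `v`. The `r` east steps at the junction form a run that
  -- is still open, and `v` must not prolong it. Reversal changes the order of the runs, hence the
  -- permutation.
  eastRuns-ʳ++ : ∀ w r v → NoFinalE v →
    eastRuns (w ʳ++ (replicate r E ++ v)) ↭ eastRunsAfter r w ++ eastRuns v
  eastRuns-ʳ++ [] r v noE = ↭-reflexive (≡.trans (eastRuns-replicate r v noE) (closeRun-++ r [] _))
  eastRuns-ʳ++ (E ∷ w) r v noE = eastRuns-ʳ++ w (suc r) v noE
  eastRuns-ʳ++ (N ∷ w) r v noE =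
    trans (eastRuns-ʳ++ w 0 (N ∷ replicate r E ++ v) tt) (move-run w r v noE)
  eastRuns-ʳ++ (D ∷ w) r v noE =
    trans (eastRuns-ʳ++ w 0 (D ∷ replicate r E ++ v) tt) (move-run w r v noE)

  eastRuns-reverse : ∀ w → eastRuns (reverse w) ↭ eastRuns w
  eastRuns-reverse w = trans (eastRuns-ʳ++ w 0 [] tt) (↭-reflexive (++-identityʳ (eastRuns w)))

  -- Paths read backwards

  module _ (k : ℕ) where

    -- Words are read backwards here, so that the last step is at the head.
    data RevPath : ℕ → ℕ → List Step → Set where
      start : RevPath 0 0 []
      east  : ∀ {x y w} → k * suc x ≤ y → RevPath x y w → RevPath (suc x) y (E ∷ w)
      north : ∀ {x y w} → RevPath x y w → RevPath x (suc y) (N ∷ w)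
      diag  : ∀ {x y w} j → suc y ≡ k * j + k → RevPath x y w → RevPath (suc x) (suc y) (D ∷ w)

    -- Only east steps carry a test against the line. A north step moves away from it; for a
    -- diagonal step, `k * x ≤ y < k * suc j` gives `x ≤ j`, hence `k * suc x ≤ k * suc j`, the
    -- height reached.
    above : ∀ {x y w} → RevPath x y w → k * x ≤ y
    above start           = ≤-reflexive (*-zeroʳ k)
    above (east k*x≤y _)  = k*x≤y
    above (north p)       = m≤n⇒m≤1+n (above p)
    above (diag {x} {y} j eq p) = ≤-trans (*-monoʳ-≤ k (*-cancelˡ-< k x (suc j) kx<)) (≤-reflexive (sym eq′))
      where
      eq′ : suc y ≡ k * suc j
      eq′ = ≡.trans eq (≡.trans (+-comm (k * j) k) (sym (*-suc k j)))
      kx< : k * x < k * suc j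
      kx< = subst (k * x <_) eq′ (s≤s (above p))

    toPath : ∀ {x y q u v} → RevPath x y u → PathFromTo k (x , y) q v →
             PathFromTo k (0 , 0) q (u ʳ++ v)
    toPath start             q = q
    toPath (east k*x≤y p)    q = toPath p (step (above p) east q)
    toPath (north p)         q = toPath p (step (above p) north q)
    toPath (diag j eq p)     q = toPath p (step (above p) (diag j eq) q)

    above-start : ∀ {p q w} → PathFromTo k p q w → Above k p
    above-start (stop a)     = a
    above-start (step a _ _) = a

    fromPath : ∀ {x y x′ y′ u v} → RevPath x y u → PathFromTo k (x , y) (x′ , y′) v →
               RevPath x′ y′ (v ʳ++ u)
    fromPath p (stop _)                 = p
    fromPath p (step _ east q)          = fromPath (east (above-start q) p) q
    fromPath p (step _ north q)         = fromPath (north p) q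
    fromPath p (step _ (diag j eq) q)   = fromPath (diag j eq p) q

    path⇔revPath : ∀ {x y w} → PathFromTo k (0 , 0) (x , y) w ⇔ RevPath x y (reverse w)
    path⇔revPath {x} {y} {w} = mk⇔ (fromPath start) (λ p → subst (PathFromTo k (0 , 0) (x , y))
      (reverse-involutive w) (toPath p (stop (above p))))

    sum-eastRuns≤ : ∀ {x y w} r → RevPath x y w → sum (eastRunsAfter r w) ≤ r + x
    sum-eastRuns≤ zero    start        = z≤n
    sum-eastRuns≤ (suc r) start        = ≤-refl
    sum-eastRuns≤ r (east {x} _ p)     = ≤-trans (sum-eastRuns≤ (suc r) p) (≤-reflexive (sym (+-suc r x)))
    sum-eastRuns≤ zero    (north p)    = sum-eastRuns≤ 0 p
    sum-eastRuns≤ (suc r) (north p)    = +-monoʳ-≤ (suc r) (sum-eastRuns≤ 0 p)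
    sum-eastRuns≤ zero    (diag _ _ p) = m≤n⇒m≤1+n (sum-eastRuns≤ 0 p)
    sum-eastRuns≤ (suc r) (diag _ _ p) = +-monoʳ-≤ (suc r) (m≤n⇒m≤1+n (sum-eastRuns≤ 0 p))

    Ends : (x y : ℕ) → List ℕ → List Step → Set
    Ends x y μ w = RevPath x y w × eastRuns w ↭ μ

    EndsNoE : (x y : ℕ) → List ℕ → List Step → Set
    EndsNoE x y μ w = Ends x y μ w × NoFinalE w

    ends-sum≤ : ∀ {x y μ w} → Ends x y μ w → sum μ ≤ x
    ends-sum≤ (p , runs) = ≤-trans (≤-reflexive (sym (sum-↭ runs))) (sum-eastRuns≤ 0 p)

    strip-east : ∀ {x y} v {w} → RevPath x y (replicate v E ++ w) → v ≤ x × RevPath (x ∸ v) y w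
    strip-east zero    p          = z≤n , p
    strip-east (suc v) (east _ p) = let v≤ , q = strip-east v p in s≤s v≤ , q

    -- Testing the right end of the run is enough, because the line is no higher at the points to
    -- its left.
    extend-east : ∀ {x y w} → k * x ≤ y → ∀ v → v ≤ x → RevPath (x ∸ v) y w →
                  RevPath x y (replicate v E ++ w)
    extend-east kx≤y zero    _          p = p
    extend-east {suc x} kx≤y (suc v) (s≤s v≤x) p =
      east kx≤y (extend-east (≤-trans (*-monoʳ-≤ k (n≤1+n x)) kx≤y) v v≤x p)

  final-run : ∀ w → ∃[ v ] ∃[ u ] NoFinalE u × w ≡ replicate v E ++ u
  final-run []      = 0 , [] , tt , refl
  final-run (E ∷ w) = let v , u , noE , eq = final-run w in suc v , u , noE , cong (E ∷_) eq
  final-run (N ∷ w) = 0 , N ∷ w , tt , refl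
  final-run (D ∷ w) = 0 , D ∷ w , tt , refl

  replicate-E-injective : ∀ a b {u w} → NoFinalE u → NoFinalE w →
                          replicate a E ++ u ≡ replicate b E ++ w → a ≡ b
  replicate-E-injective zero    zero    _  _  _  = refl
  replicate-E-injective zero    (suc b) () _  refl
  replicate-E-injective (suc a) zero    _  () refl
  replicate-E-injective (suc a) (suc b) nu nw eq =
    cong suc (replicate-E-injective a b nu nw (∷-injectiveʳ eq))

  -- Binomial coefficients

  C-absorb : ∀ r l → suc l * (suc r C suc l) ≡ suc r * (r C l)
  C-absorb zero zero = refl
  C-absorb zero (suc l) = *-zeroʳ (suc (suc l))
  C-absorb (suc r) zero = begin
    1 * (suc (suc r) C 1) ≡⟨ cong (1 *_) (nC1≡n (suc (suc r))) ⟩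
    1 * suc (suc r)       ≡⟨ *-comm 1 (suc (suc r)) ⟩
    suc (suc r) * 1       ∎
  C-absorb (suc r) (suc l) = begin
    suc (suc l) * (suc (suc r) C suc (suc l))
      ≡⟨ cong (suc (suc l) *_) (nCk+nC[k+1]≡[n+1]C[k+1] (suc r) (suc l)) ⟨
    suc (suc l) * (x + z)
      ≡⟨ split l x z ⟩
    x + (suc l * x + suc (suc l) * z)
      ≡⟨ cong (x +_) (cong₂ _+_ (C-absorb r l) (C-absorb r (suc l))) ⟩
    x + (suc r * (r C l) + suc r * (r C suc l))
      ≡⟨ cong (x +_) (*-distribˡ-+ (suc r) (r C l) (r C suc l)) ⟨
    x + suc r * (r C l + r C suc l)
      ≡⟨ cong (λ t → x + suc r * t) (nCk+nC[k+1]≡[n+1]C[k+1] r l) ⟩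
    suc (suc r) * x ∎
    where
    x = suc r C suc l
    z = suc r C suc (suc l)
    split : ∀ l x z → suc (suc l) * (x + z) ≡ x + (suc l * x + suc (suc l) * z)
    split = solve-∀

  -- r (r − 1) ⋯ (r − l + 1); unlike _P_, defined so that Pascal's rule applies.
  fall : ℕ → ℕ → ℕ
  fall r l = (r C l) * l !

  fall-pascal : ∀ r l → fall (suc r) (suc l) ≡ fall r (suc l) + suc l * fall r l
  fall-pascal r l = begin
    (suc r C suc l) * (suc l * l !)         ≡⟨ cong (_* suc l !) (nCk+nC[k+1]≡[n+1]C[k+1] r l) ⟨
    (r C l + r C suc l) * (suc l * l !)     ≡⟨ eq l (r C l) (r C suc l) (l !) ⟩
    (r C suc l) * (suc l * l !) + suc l * ((r C l) * l !) ∎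
    where
    eq : ∀ l a b f → (a + b) * (suc l * f) ≡ b * (suc l * f) + suc l * (a * f)
    eq = solve-∀

  fall-suc : ∀ r l → suc r * fall r l ≡ fall (suc r) (suc l)
  fall-suc r l = begin
    suc r * ((r C l) * l !)           ≡⟨ *-assoc (suc r) (r C l) (l !) ⟨
    suc r * (r C l) * l !             ≡⟨ cong (_* l !) (C-absorb r l) ⟨
    suc l * (suc r C suc l) * l !     ≡⟨ eq (suc l) (suc r C suc l) (l !) ⟩
    (suc r C suc l) * (suc l * l !)   ∎
    where
    eq : ∀ a b c → a * b * c ≡ b * (a * c)
    eq = solve-∀

  -- C(n, d − 1), with value 0 at d = 0, where n C pred d would be 1.
  C⁻ : ℕ → ℕ → ℕ
  C⁻ n zero    = 0
  C⁻ n (suc d) = n C d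

  C⁻-pascal : ∀ n d → C⁻ n d + n C d ≡ suc n C d
  C⁻-pascal n zero    = refl
  C⁻-pascal n (suc d) = nCk+nC[k+1]≡[n+1]C[k+1] n d

  C⁻-absorb : ∀ n d → suc n * C⁻ n d ≡ d * (suc n C d)
  C⁻-absorb n zero    = *-zeroʳ n
  C⁻-absorb n (suc d) = sym (C-absorb n d)

  -- Multiplicities of parts

  module _ {_∙_ : ℕ → ℕ → ℕ} (assoc : Associative _∙_) (comm : Commutative _∙_)
           (ε c : ℕ) {f g : ℕ → ℕ} {j : ℕ} where

    private
      fold : (ℕ → ℕ) → List ℕ → ℕ
      fold h xs = foldr _∙_ ε (map h xs)

    -- A single proof serves the product of factorials and the sum over distinct parts. As `xs` has
    -- no repetitions, `j` is met once and `c` is extracted once.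
    fold-update : f j ≡ c ∙ g j → (∀ {i} → i ≢ j → f i ≡ g i) →
                  ∀ {xs} → Unique xs → j ∈ xs → fold f xs ≡ c ∙ fold g xs
    fold-update fj f≗g {_ ∷ xs} (x≢ ∷ _) (here refl) = begin
      f j ∙ fold f xs         ≡⟨ cong₂ _∙_ fj (same (All.map ≢-sym x≢)) ⟩
      (c ∙ g j) ∙ fold g xs   ≡⟨ assoc c (g j) (fold g xs) ⟩
      c ∙ (g j ∙ fold g xs)   ∎
      where
      same : ∀ {xs} → All (_≢ j) xs → fold f xs ≡ fold g xs
      same []         = refl
      same (i≢ ∷ is≢) = cong₂ _∙_ (f≗g i≢) (same is≢)
    fold-update fj f≗g {x ∷ xs} (x≢ ∷ uniq) (there j∈) = begin
      f x ∙ fold f xs         ≡⟨ cong₂ _∙_ (f≗g (All.lookup x≢ j∈)) (fold-update fj f≗g uniq j∈) ⟩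
      g x ∙ (c ∙ fold g xs)   ≡⟨ assoc (g x) c _ ⟨
      (g x ∙ c) ∙ fold g xs   ≡⟨ cong (_∙ fold g xs) (comm (g x) c) ⟩
      (c ∙ g x) ∙ fold g xs   ≡⟨ assoc c (g x) _ ⟩
      c ∙ (g x ∙ fold g xs)   ∎

  count : ℕ → List ℕ → ℕ
  count v μ = length (filter (v ≟_) μ)

  count-here : ∀ v μ → count v (v ∷ μ) ≡ suc (count v μ)
  count-here v μ = cong length (filter-accept (v ≟_) {v} {μ} refl)

  count-there : ∀ {v u} → v ≢ u → ∀ μ → count v (u ∷ μ) ≡ count v μ
  count-there {v} v≢u μ = cong length (filter-reject (v ≟_) {xs = μ} v≢u)

  count-↭ : ∀ v {μ ν} → μ ↭ ν → count v μ ≡ count v ν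
  count-↭ v = ↭-length ∘ filter-↭ (v ≟_)

  -- This is m_μ without a bound on the parts: the copies of a part `v`, from the last to the first,
  -- contribute 1, 2, 3 and so on, which multiply to the factorial of its multiplicity.
  multFact : List ℕ → ℕ
  multFact []      = 1
  multFact (v ∷ μ) = suc (count v μ) * multFact μ

  multFact-↭ : ∀ {μ ν} → μ ↭ ν → multFact μ ≡ multFact ν
  multFact-↭ refl         = refl
  multFact-↭ (prep v p)   = cong₂ _*_ (cong suc (count-↭ v p)) (multFact-↭ p)
  multFact-↭ (trans p q)  = ≡.trans (multFact-↭ p) (multFact-↭ q)
  multFact-↭ (swap {μ} {ν} u v p) with u ≟ v
  ... | yes refl = cong₂ _*_ (cong suc (count-↭ u (prep u p)))
                             (cong₂ _*_ (cong suc (count-↭ u p)) (multFact-↭ p))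
  ... | no u≢v = begin
    suc (count u (v ∷ μ)) * (suc (count v μ) * multFact μ)
      ≡⟨ cong₂ (λ a b → suc a * b) (≡.trans (count-there u≢v μ) (count-↭ u p))
           (cong₂ (λ a b → suc a * b) (count-↭ v p) (multFact-↭ p)) ⟩
    suc (count u ν) * (suc (count v ν) * multFact ν)
      ≡⟨ exchange (suc (count u ν)) (suc (count v ν)) (multFact ν) ⟩
    suc (count v ν) * (suc (count u ν) * multFact ν)
      ≡⟨ cong (λ a → suc a * (suc (count u ν) * multFact ν)) (count-there (≢-sym u≢v) ν) ⟨
    suc (count v (u ∷ ν)) * (suc (count u ν) * multFact ν) ∎
    where
    exchange : ∀ a b c → a * (b * c) ≡ b * (a * c)
    exchange = solve-∀

  multFact-remove : ∀ {v μ ν} → μ ↭ v ∷ ν → multFact μ ≡ count v μ * multFact ν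
  multFact-remove {v} {μ} {ν} p = begin
    multFact μ                      ≡⟨ multFact-↭ p ⟩
    suc (count v ν) * multFact ν    ≡⟨ cong (_* multFact ν) (count-here v ν) ⟨
    count v (v ∷ ν) * multFact ν    ≡⟨ cong (_* multFact ν) (count-↭ v p) ⟨
    count v μ * multFact ν          ∎

  -- The range of the product is allowed to exceed the largest part, so that it
  -- stays fixed in the induction on μ.
  product-upTo≡multFact : ∀ R {μ} → All NonZero μ → All (_≤ R) μ →
                          product (map (λ i → count (suc i) μ !) (upTo R)) ≡ multFact μ
  product-upTo≡multFact R [] [] = ones (upTo R)
    where
    ones : ∀ (xs : List ℕ) → product (map (λ _ → 1) xs) ≡ 1
    ones []       = refl
    ones (_ ∷ xs) = ≡.trans (+-identityʳ _) (ones xs)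
  product-upTo≡multFact R {suc j ∷ μ} (_ ∷ μ>0) (j<R ∷ μ≤R) = ≡.trans
    (fold-update *-assoc *-comm 1 (suc (count (suc j) μ))
      (cong _! (count-here (suc j) μ))
      (λ i≢j → cong _! (count-there (i≢j ∘ suc-injective) μ))
      (Unique.upTo⁺ R) (∈-upTo⁺ j<R))
    (cong (suc (count (suc j) μ) *_) (product-upTo≡multFact R μ>0 μ≤R))

  sum-bounds : ∀ μ → All (_≤ sum μ) μ
  sum-bounds []      = []
  sum-bounds (v ∷ μ) =
    m≤m+n v (sum μ) ∷ All.map (λ u≤ → ≤-trans u≤ (m≤n+m (sum μ) v)) (sum-bounds μ)

  multFactorial≡multFact : ∀ μ → multFactorial μ ≡ multFact (parts μ)
  multFactorial≡multFact μ = product-upTo≡multFact ∥ μ ∥ (positive μ) (sum-bounds (parts μ))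

  -- The multiplicity that `multFact-remove` produces turns a sum over distinct parts into one over
  -- all parts. The list `vs` need only contain the parts, so that it stays fixed as `μ` shrinks.
  sum-count : ∀ (g : ℕ → ℕ) {vs} → Unique vs → ∀ μ → μ ⊆ vs →
              sum (map (λ v → count v μ * g v) vs) ≡ sum (map g μ)
  sum-count g {vs} uniq [] _ = zeros vs
    where
    zeros : ∀ (xs : List ℕ) → sum (map (λ _ → 0) xs) ≡ 0
    zeros []       = refl
    zeros (_ ∷ xs) = zeros xs
  sum-count g uniq (u ∷ μ) μ⊆ = ≡.trans
    (fold-update +-assoc +-comm 0 (g u)
      (cong (_* g u) (count-here u μ))
      (λ {v} v≢u → cong (_* g v) (count-there v≢u μ))
      uniq (μ⊆ (here refl)))
    (cong (g u +_) (sum-count g uniq μ (μ⊆ ∘ there)))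

  -- Recurrences for the level totals

  -- Each summand is affine in `v`, so only `length μ` and `sum μ` matter. The negative part of the
  -- slope, `b * (i * S)`, is moved to the left to avoid subtraction; `s` is separate from `sum μ`
  -- so that it stays fixed in the induction.
  sum-affine : ∀ p b e R i s S {μ} → All (_≤ s) μ →
    sum (map (λ v → p * R + b * ((e + v) * R + i * ((s ∸ v) * S))) μ) + b * (i * (S * sum μ))
    ≡ length μ * (p * R + b * (e * R + i * (s * S))) + sum μ * (b * R)
  sum-affine p b e R i s S [] = zeroʳ b i S
    where
    zeroʳ : ∀ b i S → b * (i * (S * 0)) ≡ 0
    zeroʳ = solve-∀
  sum-affine p b e R i s S {v ∷ μ} (v≤s ∷ μ≤s) = begin
    X (s ∸ v) + Y + b * (i * (S * (v + sum μ)))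
      ≡⟨ rearrange p b e R i S v (s ∸ v) Y (sum μ) ⟩
    (p * R + b * (e * R + i * ((s ∸ v + v) * S))) + v * (b * R) + (Y + b * (i * (S * sum μ)))
      ≡⟨ cong₂ (λ t Z → (p * R + b * (e * R + i * (t * S))) + v * (b * R) + Z)
           (m∸n+n≡m v≤s) (sum-affine p b e R i s S μ≤s) ⟩
    (p * R + b * (e * R + i * (s * S))) + v * (b * R) + (length μ * U + sum μ * (b * R))
      ≡⟨ regroup U v (b * R) (length μ * U) (sum μ) ⟩
    suc (length μ) * U + (v + sum μ) * (b * R) ∎
    where
    X : ℕ → ℕ
    X t = p * R + b * ((e + v) * R + i * (t * S))
    Y = sum (map (λ v → p * R + b * ((e + v) * R + i * ((s ∸ v) * S))) μ)
    U = p * R + b * (e * R + i * (s * S))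
    rearrange : ∀ p b e R i S v t Y m →
      p * R + b * ((e + v) * R + i * (t * S)) + Y + b * (i * (S * (v + m)))
      ≡ (p * R + b * (e * R + i * ((t + v) * S))) + v * (b * R) + (Y + b * (i * (S * m)))
    rearrange = solve-∀
    regroup : ∀ U v w L m → U + v * w + (L + m * w) ≡ U + L + (v + m) * w
    regroup = solve-∀

  -- With m = kn, l = ℓ(μ), s = |μ| and d + s + e = n, this is n m_μ times the
  -- number of paths of type μ with d diagonal steps that end on y = kn + i - 1
  -- (if 1 ≤ i ≤ k), and of those that end on y = kn + i with a step other than
  -- east (if i < k).
  levelTotal : (n m i d l s e : ℕ) → ℕ
  levelTotal n m i d l s e =
    C⁻ n d * fall (i + m) l
    + (suc n C d) * (e * fall (i + m) l + i * (s * fall (pred (i + m)) (pred l)))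

  -- The two terms belong to the last step onto y = kn: before a north step `d` and `e` are the
  -- same, while before a diagonal step `d` was smaller and `e` larger by one. Pascal's rule merges
  -- their binomials.
  levelTotal-zero : ∀ n m d l s e →
    levelTotal n m 0 d l s e ≡ (n C d) * (e * fall m l) + C⁻ n d * (suc e * fall m l)
  levelTotal-zero n m d l s e = begin
    c * T + (suc n C d) * (e * T + 0)   ≡⟨ cong (λ b → c * T + b * (e * T + 0)) (C⁻-pascal n d) ⟨
    c * T + (c + n C d) * (e * T + 0) ≡⟨ eq c (n C d) e T ⟩
    (n C d) * (e * T) + c * (suc e * T) ∎
    where
    T = fall m l
    c = C⁻ n d
    eq : ∀ a b e T → a * T + (a + b) * (e * T + 0) ≡ b * (e * T) + a * (suc e * T)
    eq = solve-∀

  -- The added sum runs over the length `v` of the final run: the path before it has type μ - v, and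
  -- its `e` is larger by `v`, as the run takes up `v` columns.
  levelTotal-step : ∀ n m i d μ e → let s = sum μ in
    levelTotal n m i d (length μ) s e + sum (map (λ v → levelTotal n m i d (pred (length μ)) (s ∸ v) (e + v)) μ)
    ≡ levelTotal n m (suc i) d (length μ) s e
  levelTotal-step n m i d [] e = eq (C⁻ n d) (suc n C d) e i (fall (pred (i + m)) 0) (fall (i + m) 0)
    where
    eq : ∀ a b e i S T → a * 1 + b * (e * 1 + i * 0) + 0 ≡ a * 1 + b * (e * 1 + (0 + i * 0))
    eq = solve-∀
  levelTotal-step n m i d μ@(_ ∷ μ') e = +-cancelʳ-≡ (b * (i * (S * s))) _ _ (begin
    Fᵢ + Σ + b * (i * (S * s))
      ≡⟨ +-assoc Fᵢ Σ _ ⟩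
    Fᵢ + (Σ + b * (i * (S * s)))
      ≡⟨ cong (Fᵢ +_) (sum-affine a b e R i s S (sum-bounds μ)) ⟩
    Fᵢ + (suc l * (a * R + b * (e * R + i * (s * S))) + s * (b * R))
      ≡⟨ gather a b e i s l T R S T' ⟩
    a * (T + suc l * R) + b * (e * (T + suc l * R) + s * (i * (T' + l * S) + R)) + b * (i * (S * s))
      ≡⟨ cong₂ (λ t u → a * t + b * (e * t + s * (u + R)) + b * (i * (S * s)))
           (sym (fall-pascal (i + m) l)) (last-pascal i l) ⟩
    a * T⁺ + b * (e * T⁺ + s * (i * R + R)) + b * (i * (S * s))
      ≡⟨ finish a b e i s R S T⁺ ⟩
    levelTotal n m (suc i) d (suc l) s e + b * (i * (S * s)) ∎)
    where
    l = length μ'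
    s = sum μ
    a = C⁻ n d
    b = suc n C d
    T = fall (i + m) (suc l)
    T⁺ = fall (suc (i + m)) (suc l)
    R = fall (i + m) l
    T' = fall (pred (i + m)) l
    S = fall (pred (i + m)) (pred l)
    Fᵢ = levelTotal n m i d (suc l) s e
    Σ = sum (map (λ v → levelTotal n m i d l (s ∸ v) (e + v)) μ)
    -- The factor `i` matters: at `i` = `m` = 0 the truncated `pred` would make Pascal's rule false.
    -- At `l` = 0 the truncated `pred l` occurs only with factor 0.
    last-pascal : ∀ i l → i * (fall (pred (i + m)) l + l * fall (pred (i + m)) (pred l)) ≡ i * fall (i + m) l
    last-pascal zero    _       = refl
    last-pascal (suc i) zero    = refl
    last-pascal (suc i) (suc l) = cong (suc i *_) (sym (fall-pascal (i + m) l))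
    gather : ∀ a b e i s l T R S T' →
      a * T + b * (e * T + i * (s * T')) + (suc l * (a * R + b * (e * R + i * (s * S))) + s * (b * R))
      ≡ a * (T + suc l * R) + b * (e * (T + suc l * R) + s * (i * (T' + l * S) + R)) + b * (i * (S * s))
    gather = solve-∀
    finish : ∀ a b e i s R S T → a * T + b * (e * T + s * (i * R + R)) + b * (i * (S * s))
      ≡ a * T + b * (e * T + suc i * (s * R)) + b * (i * (S * s))
    finish = solve-∀

  -- For positive `l` this is absorption. For `l` = 0, where `pred l` is truncated, it holds because
  -- `s` is 0, as for the empty partition.
  fall-shrink : ∀ r l s → (l ≡ 0 → s ≡ 0) → suc r * (s * fall r (pred l)) ≡ s * fall (suc r) l
  fall-shrink r zero s s≡0 rewrite s≡0 refl = *-zeroʳ r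
  fall-shrink r (suc l) s _ = begin
    suc r * (s * fall r l)      ≡⟨ eq (suc r) s (fall r l) ⟩
    s * (suc r * fall r l)      ≡⟨ cong (s *_) (fall-suc r l) ⟩
    s * fall (suc r) (suc l)    ∎
    where
    eq : ∀ a b c → a * (b * c) ≡ b * (a * c)
    eq = solve-∀

  -- After multiplication by n + 1, absorption makes all three terms multiples of `b * T`, with
  -- coefficients `d`, (n + 1) e and `s`. As d + s + e = n, these add up to n (e + 1), the source of
  -- the new factor `suc e`.
  levelTotal-last : ∀ k n d l s e → (l ≡ 0 → s ≡ 0) → d + s + e ≡ n →
    suc n * levelTotal n (suc k * n) (suc k) d l s e ≡ n * ((suc n C d) * (suc e * fall (suc k * suc n) l))
  levelTotal-last k n d l s e s≡0 sum≡n = begin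
    suc n * levelTotal n (suc k * n) (suc k) d l s e
      ≡⟨ expand n (suc k) (C⁻ n d) b e T s S ⟩
    suc n * C⁻ n d * T + b * (suc n * e * T + (suc k * suc n) * (s * S))
      ≡⟨ cong₂ (λ u w → u * T + b * (suc n * e * T + w)) (C⁻-absorb n d)
           (≡.trans (cong (_* (s * S)) (*-suc (suc k) n)) (fall-shrink (k + suc k * n) l s s≡0)) ⟩
    d * b * T + b * (suc n * e * T + s * T)
      ≡⟨ collect d b T n e s ⟩
    b * T * (n * e + (d + s + e))
      ≡⟨ cong (λ t → b * T * (n * e + t)) sum≡n ⟩
    b * T * (n * e + n)
      ≡⟨ rotate b T n e ⟩
    n * (b * (suc e * T))
      ≡⟨ cong (λ r → n * (b * (suc e * fall r l))) (*-suc (suc k) n) ⟨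
    n * (b * (suc e * fall (suc k * suc n) l)) ∎
    where
    b = suc n C d
    T = fall (suc k + suc k * n) l
    S = fall (k + suc k * n) (pred l)
    expand : ∀ n k c b e T s S → suc n * (c * T + b * (e * T + k * (s * S)))
      ≡ suc n * c * T + b * (suc n * e * T + (k * suc n) * (s * S))
    expand = solve-∀
    collect : ∀ d b T n e s → d * b * T + b * (suc n * e * T + s * T) ≡ b * T * (n * e + (d + s + e))
    collect = solve-∀
    rotate : ∀ b T n e → b * T * (n * e + n) ≡ n * (b * (suc e * T))
    rotate = solve-∀

  -- Counting level by level

  length≡0⇒sum≡0 : ∀ μ → length μ ≡ 0 → sum μ ≡ 0
  length≡0⇒sum≡0 [] _ = refl

  ∈-remove : ∀ {v} {μ : List ℕ} → v ∈ μ → ∃[ ν ] μ ↭ v ∷ ν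
  ∈-remove v∈ with xs , ys , refl ← ∈-∃++ v∈ = xs ++ ys , shift _ xs ys

  counts-scale : ∀ {S : Set} {P : S → Set} j {K K′ z} → K′ ≡ j * K → Counts P K z → Counts P K′ (j * z)
  counts-scale j {K} refl (counted {c} card refl) = counted card (*-assoc j K c)

  counts-subst : ∀ {S : Set} {P : S → Set} {K z z′} → z ≡ z′ → Counts P K z → Counts P K z′
  counts-subst refl = id

  module _ (k-1 : ℕ) where

    private k = suc k-1

    -- For `suc y ≡ k * n` this is the claim about A(n, d, μ). The abscissa records `d`, because
    -- only east and diagonal steps increase it, and `e` = n - d - s is a variable to avoid
    -- truncated subtraction.
    BlockCount : (n y : ℕ) → Set
    BlockCount n y = ∀ d e μ → All NonZero μ → d + sum μ + e ≡ n →
      Counts (Ends k (d + sum μ) y μ) (n * multFact μ) ((n C d) * (e * fall (k * n) (length μ)))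

    EndsNoECount EndsCount : (n i y : ℕ) → Set
    EndsNoECount n i y = ∀ d e μ → All NonZero μ → d + sum μ + e ≡ n →
      Counts (EndsNoE k (d + sum μ) y μ) (n * multFact μ) (levelTotal n (k * n) i d (length μ) (sum μ) e)
    EndsCount n i y = ∀ d e μ → All NonZero μ → d + sum μ + e ≡ n →
      Counts (Ends k (d + sum μ) y μ) (n * multFact μ) (levelTotal n (k * n) i d (length μ) (sum μ) e)

    -- `v ∷ eastRuns u ↭ μ` gives the rest type μ - v without choosing a list for μ - v.
    EndsRun : (x y : ℕ) → List ℕ → ℕ → List Step → Set
    EndsRun x y μ v =
      Image (replicate v E ++_) (λ u → (RevPath k (x ∸ v) y u × v ∷ eastRuns u ↭ μ) × NoFinalE u)

    -- The final east run is empty or is one of the parts of `μ`; `deduplicate` lists each possible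
    -- length once, so that no path is counted twice.
    ends⇔ : ∀ {x y μ w} → k * x ≤ y → sum μ ≤ x → All NonZero μ →
            (EndsNoE k x y μ w ⊎ Any (λ v → EndsRun x y μ v w) (deduplicate _≟_ μ)) ⇔ Ends k x y μ w
    ends⇔ {x} {y} {μ} {w} kx≤y s≤x μ>0 = mk⇔ join split
      where
      join : EndsNoE k x y μ w ⊎ Any (λ v → EndsRun x y μ v w) (deduplicate _≟_ μ) → Ends k x y μ w
      join (inj₁ (ends , _)) = ends
      join (inj₂ any) with find any
      ... | v , v∈′ , u , ((p , runs) , noE) , refl
        with v∈ ← ∈-deduplicate⁻ _≟_ μ v∈′
        -- Parts are positive, so the run does appear in `eastRuns`; being at most `sum μ ≤ x`, it
        -- leaves `x ∸ v` untruncated.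
        with v | All.lookup μ>0 v∈ | All.lookup (sum-bounds μ) v∈
      ... | suc v | _ | v≤s =
        extend-east k kx≤y (suc v) (≤-trans v≤s s≤x) p ,
        trans (↭-reflexive (eastRuns-replicate (suc v) u noE)) runs

      split : Ends k x y μ w → EndsNoE k x y μ w ⊎ Any (λ v → EndsRun x y μ v w) (deduplicate _≟_ μ)
      split (p , runs) with final-run w
      ... | zero  , u , noE , refl = inj₁ ((p , runs) , noE)
      ... | suc v , u , noE , refl = inj₂ (lose
        (∈-deduplicate⁺ _≟_ (∈-resp-↭ runs′ (here refl)))
        (u , ((proj₂ (strip-east k (suc v) p) , runs′) , noE) , refl))
        where runs′ = trans (↭-reflexive (sym (eastRuns-replicate (suc v) u noE))) runs

    -- Height kn + i has index `i` for paths whose last step is not east and index `suc i` for all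
    -- paths. Since x ≤ n and kn ≤ y, the line does not obstruct the final run.
    add-run : ∀ {n i y} → k * n ≤ y → EndsNoECount n i y → EndsCount n (suc i) y
    add-run {n} {i} {y} kn≤y counts d e μ μ>0 total =
      counts-subst (≡.trans (cong (levelTotal n (k * n) i d (length μ) s e +_)
                      (sum-count g (deduplicate-! μ) μ (∈-deduplicate⁺ _≟_)))
                      (levelTotal-step n (k * n) i d μ e))
        (counts-map (card-cong (λ w → ends⇔ kx≤y (m≤n+m s d) μ>0))
          (counts-⊎ not-both (counts d e μ μ>0 total)
            (counts-Any same-run (deduplicate-! μ) (All.tabulate counts-run))))
      where
      s = sum μ
      g : ℕ → ℕ
      g v = levelTotal n (k * n) i d (pred (length μ)) (s ∸ v) (e + v)

      kx≤y : k * (d + s) ≤ y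
      kx≤y = ≤-trans (*-monoʳ-≤ k (≤-trans (m≤m+n (d + s) e) (≤-reflexive total))) kn≤y

      not-both : ∀ {w} → EndsNoE k (d + s) y μ w → ¬ Any (λ v → EndsRun (d + s) y μ v w) (deduplicate _≟_ μ)
      not-both (_ , noE) any with find any
      ... | v , v∈ , u , _ , refl with v | All.lookup μ>0 (∈-deduplicate⁻ _≟_ μ v∈)
      ... | suc _ | _ = noE

      same-run : ∀ {a b w} → EndsRun (d + s) y μ a w → EndsRun (d + s) y μ b w → a ≡ b
      same-run {a} {b} (u , (_ , noE) , refl) (u′ , (_ , noE′) , eq) =
        replicate-E-injective a b noE noE′ eq

      counts-run : ∀ {v} → v ∈ deduplicate _≟_ μ →
        Counts (EndsRun (d + s) y μ v) (n * multFact μ) (count v μ * g v)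
      counts-run {v} v∈ with ν , μ↭ ← ∈-remove (∈-deduplicate⁻ _≟_ μ v∈) =
        counts-scale (count v μ)
          (≡.trans (cong (n *_) (multFact-remove μ↭)) (exchange n (count v μ) (multFact ν)))
          (counts-subst (cong₂ (λ l t → levelTotal n (k * n) i d l t (e + v)) (cong pred (sym (↭-length μ↭))) s-v)
            (counts-map (card-image (++-cancelˡ (replicate v E) _ _) ∘ card-cong same)
              (counts d (e + v) ν (All.tail (All-resp-↭ μ↭ μ>0)) total′)))
        where
        s≡ : s ≡ v + sum ν
        s≡ = sum-↭ μ↭
        s-v : sum ν ≡ s ∸ v
        s-v = sym (≡.trans (cong (_∸ v) s≡) (m+n∸m≡n v (sum ν)))
        x-v : d + sum ν ≡ d + s ∸ v
        x-v = sym (≡.trans (cong (λ t → d + t ∸ v) s≡) (≡.trans (cong (_∸ v) (swap-+ d v (sum ν))) (m+n∸m≡n v _)))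
          where
          swap-+ : ∀ a b c → a + (b + c) ≡ b + (a + c)
          swap-+ = solve-∀
        total′ : d + sum ν + (e + v) ≡ n
        total′ = ≡.trans (regroup d (sum ν) e v) (≡.trans (cong (λ t → d + t + e) (sym s≡)) total)
          where
          regroup : ∀ d t e v → d + t + (e + v) ≡ d + (v + t) + e
          regroup = solve-∀
        exchange : ∀ a b c → a * (b * c) ≡ b * (a * c)
        exchange = solve-∀
        same : ∀ u → EndsNoE k (d + sum ν) y ν u ⇔
                     ((RevPath k (d + s ∸ v) y u × v ∷ eastRuns u ↭ μ) × NoFinalE u)
        same u = mk⇔
          (λ ((p , runs) , noE) →
            (subst (λ x → RevPath k x y u) x-v p , trans (prep v runs) (↭-sym μ↭)) , noE)
          (λ ((p , runs) , noE) →
            (subst (λ x → RevPath k x y u) (sym x-v) p , drop-∷ (trans runs μ↭)) , noE)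

    north-image : ∀ {x y μ} {c} → HasCardinality (Ends k x y μ) c →
                  HasCardinality (Image (N ∷_) (Ends k x y μ)) c
    north-image = card-image ∷-injectiveʳ

    -- The height `suc y` is not a multiple of `k`, whereas diagonal steps end at multiples of `k`;
    -- only a north step can lead here.
    within-block : ∀ {n i y} → suc y ≡ suc i + k * n → suc i < k → EndsCount n (suc i) y → EndsNoECount n (suc i) (suc y)
    within-block {n} {i} {y} y≡ i<k counts d e μ μ>0 total =
      counts-map (card-cong (λ w → mk⇔ extend restrict) ∘ north-image) (counts d e μ μ>0 total)
      where
      extend : ∀ {w} → Image (N ∷_) (Ends k (d + sum μ) y μ) w → EndsNoE k (d + sum μ) (suc y) μ w
      extend (u , (p , runs) , refl) = (north p , runs) , tt
      restrict : ∀ {x w} → EndsNoE k x (suc y) μ w → Image (N ∷_) (Ends k x y μ) w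
      restrict ((north p , runs) , _) = _ , (p , runs) , refl
      restrict ((diag j eq p , runs) , _) = contradiction (∣⇒≤ k∣i+1) (<⇒≱ i<k)
        where
        k∣i+1 : k ∣ suc i
        k∣i+1 = ∣m+n∣m⇒∣n (divides (suc j) (≡.trans (≡.trans (+-comm (k * n) (suc i)) (≡.trans (sym y≡) eq)) (eq′ k j))) (m∣m*n n)
          where
          eq′ : ∀ k j → k * j + k ≡ suc j * k
          eq′ = solve-∀

    enter-block : ∀ {n y} → suc y ≡ k * n → BlockCount n y → EndsNoECount n 0 (suc y)
    enter-block {n} {y} y≡ counts d e μ μ>0 total =
      counts-subst (sym (levelTotal-zero n (k * n) d (length μ) (sum μ) e))
        (counts-map (card-cong λ w → mk⇔ [ extend , proj₁ ]′ split)
          (counts-⊎ (λ { (_ , _ , refl) (_ , ()) })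
            (counts-map north-image (counts d e μ μ>0 total))
            (diagonal d total)))
      where
      Diagonal : ℕ → List Step → Set
      Diagonal x w = EndsNoE k x (suc y) μ w × (∃[ u ] w ≡ D ∷ u)

      extend : ∀ {w} → Image (N ∷_) (Ends k (d + sum μ) y μ) w → EndsNoE k (d + sum μ) (suc y) μ w
      extend (u , (p , runs) , refl) = (north p , runs) , tt

      split : ∀ {x w} → EndsNoE k x (suc y) μ w → Image (N ∷_) (Ends k x y μ) w ⊎ Diagonal x w
      split ((north p , runs) , _)          = inj₁ (_ , (p , runs) , refl)
      split q@((diag _ _ _ , _) , _) = inj₂ (q , _ , refl)

      diagonal : ∀ d → d + sum μ + e ≡ n →
        Counts (Diagonal (d + sum μ)) (n * multFact μ) (C⁻ n d * (suc e * fall (k * n) (length μ)))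
      -- With `d` = 0 the abscissa before a final diagonal step would be `sum μ` - 1, too small for
      -- the east runs.
      diagonal zero    _ = counts-∅ (λ w → none refl)
        where
        none : ∀ {x w} → x ≡ sum μ → ¬ Diagonal x w
        none x≡ (((diag _ _ p , runs) , _) , _) =
          contradiction (ends-sum≤ k (p , runs)) (<⇒≱ (≤-reflexive x≡))
        none _  (((east _ _ , _) , ()) , _)
      diagonal (suc d) total = counts-map (card-cong (λ w → mk⇔ add remove) ∘ card-image ∷-injectiveʳ)
        (counts d (suc e) μ μ>0 (≡.trans (+-suc (d + sum μ) e) total))
        where
        -- The integer `j` of the final diagonal step is n - 1, which `total` expresses as
        -- `d + sum μ + e`.
        y+1≡ : suc y ≡ k * (d + sum μ + e) + k
        y+1≡ = ≡.trans y≡ (≡.trans (cong (k *_) (sym total)) (≡.trans (*-suc k _) (+-comm k _)))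
        add : ∀ {w} → Image (D ∷_) (Ends k (d + sum μ) y μ) w → Diagonal (suc d + sum μ) w
        add (u , (p , runs) , refl) = ((diag (d + sum μ + e) y+1≡ p , runs) , tt) , u , refl
        remove : ∀ {w} → Diagonal (suc d + sum μ) w → Image (D ∷_) (Ends k (d + sum μ) y μ) w
        remove (((diag _ _ p , runs) , _) , u , refl) = u , (p , runs) , refl

    -- The first k n levels never reach x = n.
    full-block : ∀ {n y} → suc y ≡ k * n → ∀ d μ → d + sum μ + 0 ≡ n →
      Counts (Ends k (d + sum μ) y μ) (n * multFact μ) ((n C d) * (0 * fall (k * n) (length μ)))
    full-block {n} y≡ d μ total = counts-subst (sym (*-zeroʳ (n C d))) (counts-∅ λ w (p , _) →
      <⇒≱ (≤-reflexive (≡.trans y≡ (cong (k *_) (≡.trans (sym total) (+-identityʳ _))))) (above k p))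

    -- The line y = k(n + 1) - 1 has index `k` when counted from y = kn, so only the scale factor
    -- `n` must become `suc n`. Cancelling `n` requires it to be nonzero; hence the induction starts
    -- at 1.
    leave-block : ∀ {n y} .{{_ : NonZero n}} → suc y ≡ k * suc n → EndsCount n k y → BlockCount (suc n) y
    leave-block y≡ counts d zero    μ μ>0 total = full-block y≡ d μ total
    leave-block {n} y≡ counts d (suc e) μ μ>0 total
      with total′ ← suc-injective (≡.trans (sym (+-suc (d + sum μ) e)) total)
      with counted {c} card eq ← counts d e μ μ>0 total′ =
      counted card (*-cancelˡ-≡ _ _ n (begin
        n * (suc n * multFact μ * c)                           ≡⟨ exchange n (suc n) (multFact μ) c ⟩
        suc n * (n * multFact μ * c)                           ≡⟨ cong (suc n *_) eq ⟩
        suc n * levelTotal n (k * n) k d (length μ) (sum μ) e           ≡⟨ levelTotal-last k-1 n d (length μ) (sum μ) e (length≡0⇒sum≡0 μ) total′ ⟩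
        n * ((suc n C d) * (suc e * fall (k * suc n) (length μ))) ∎))
      where
      exchange : ∀ n m f c → n * (m * f * c) ≡ m * (n * f * c)
      exchange = solve-∀

    only-north : ∀ {y w} → RevPath k 0 y w → w ≡ replicate y N
    only-north start     = refl
    only-north (north p) = cong (N ∷_) (only-north p)

    all-north : ∀ y → Ends k 0 y [] (replicate y N)
    all-north zero    = start , refl
    all-north (suc y) = let p , runs = all-north y in north p , runs

    -- On y = k - 1 only the abscissa 0 is above the line y = kx, and the one path to that point
    -- consists of north steps.
    first-block : ∀ {y} → suc y ≡ k * 1 → BlockCount 1 y
    first-block y≡ d zero μ _ total = full-block y≡ d μ total
    first-block {y} _ zero 1 [] _ _ = counted (card-singleton (all-north y) (λ w (p , _) → only-north p)) refl
    first-block _ zero (suc _) (suc _ ∷ μ) _ total =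
      contradiction (≡.trans (sym (+-suc _ _)) (suc-injective total)) λ ()
    first-block _ zero (suc _) (zero ∷ _) (() ∷ _) _
    first-block _ (suc d) (suc e) μ _ total =
      contradiction (≡.trans (sym (+-suc (d + sum μ) e)) (suc-injective total)) λ ()

    within-blocks : ∀ n .{{_ : NonZero n}} → (∀ {y} → suc y ≡ k * n → BlockCount n y) →
                    ∀ i → i < k → EndsCount n (suc i) (i + k * n)
    within-blocks (suc n) block zero    _   = add-run {i = 0} ≤-refl (enter-block refl (block refl))
    within-blocks n       block (suc i) i<k = add-run {i = suc i} (m≤n+m (k * n) (suc i))
      (within-block {i = i} refl i<k (within-blocks n block i (<⇒≤ i<k)))

    block-count : ∀ n {y} → suc y ≡ k * suc n → BlockCount (suc n) y
    block-count zero    y≡ = first-block y≡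
    block-count (suc n) y≡ with refl ← suc-injective (≡.trans y≡ (*-suc k (suc n))) =
      leave-block y≡ (within-blocks (suc n) (block-count n) k-1 ≤-refl)

  -- Large paths and their last step

  last-∷ʳ : ∀ {S : Set} (xs : List S) x → last (xs ∷ʳ x) ≡ just x
  last-∷ʳ []           x = refl
  last-∷ʳ (_ ∷ [])     x = refl
  last-∷ʳ (_ ∷ y ∷ xs) x = last-∷ʳ (y ∷ xs) x

  last-reverse : ∀ {S : Set} (x : S) xs → last (reverse (x ∷ xs)) ≡ just x
  last-reverse x xs = ≡.trans (cong last (unfold-reverse x xs)) (last-∷ʳ (reverse xs) x)

  module _ (k : ℕ) (μ : List ℕ) where

    path⇔ends : ∀ {x y} w →
      (PathFromTo k (0 , 0) (x , y) w × eastRuns w ↭ μ) ⇔ Image reverse (Ends k x y μ) w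
    path⇔ends {x} {y} w = mk⇔
      (λ (p , runs) →
        reverse w , (to (path⇔revPath k) p , trans (eastRuns-reverse w) runs) ,
        sym (reverse-involutive w))
      (λ { (u , (p , runs) , refl) →
        from (path⇔revPath k) (subst (RevPath k x y) (sym (reverse-involutive u)) p) ,
        trans (eastRuns-reverse u) runs })

    -- Removing the final diagonal step leaves a path that ends one level below the line it enters,
    -- a case covered by `block-count`.
    diagonalPath⇔ends : ∀ {n y} → suc y ≡ k * suc n → ∀ w →
      (LargePath k (suc n) w × eastRuns w ↭ μ × last w ≡ just D) ⇔
      Image (reverse ∘ (D ∷_)) (Ends k n y μ) w
    diagonalPath⇔ends {n} {y} y≡ w = mk⇔
      (λ (p , runs , end) → remove (to (path⇔ends w) (p , runs)) end)
      (λ { (u , (p , runs) , refl) →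
        let q , runs′ = from (path⇔ends w) (D ∷ u , (add-diag p , runs) , refl) in
        q , runs′ , last-reverse D u })
      where
      add-diag : ∀ {u} → RevPath k n y u → RevPath k (suc n) (k * suc n) (D ∷ u)
      add-diag {u} p = subst (λ z → RevPath k (suc n) z (D ∷ u)) y≡
        (diag n (≡.trans y≡ (≡.trans (*-suc k n) (+-comm k (k * n)))) p)
      drop-diag : ∀ {z u} → suc y ≡ z → RevPath k (suc n) z (D ∷ u) → RevPath k n y u
      drop-diag refl (diag _ _ p) = p
      remove : Image reverse (Ends k (suc n) (k * suc n) μ) w → last w ≡ just D →
               Image (reverse ∘ (D ∷_)) (Ends k n y μ) w
      remove ([] , _ , refl) ()
      remove (s ∷ u , (p , runs) , refl) end with refl ← ≡.trans (sym (last-reverse s u)) end =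
        u , (drop-diag y≡ p , runs) , refl

  -- For `s < n` this is the symmetry of binomial coefficients. At `s` = `n` both sides are 0, the
  -- left one by the convention for `C⁻`.
  C⁻-complement : ∀ {n s} → s ≤ n → C⁻ n (n ∸ s) ≡ n C suc s
  C⁻-complement {n} {s} s≤n = [ below , (λ { refl → top }) ]′ (m≤n⇒m<n∨m≡n s≤n)
    where
    below : s < n → C⁻ n (n ∸ s) ≡ n C suc s
    below s<n = ≡.trans (cong (C⁻ n) (+-∸-assoc 1 s<n)) (sym (nCk≡nC[n∸k] s<n))
    top : C⁻ n (n ∸ n) ≡ n C suc n
    top = ≡.trans (cong (C⁻ n) (n∸n≡0 n)) (sym (k>n⇒nCk≡0 (n<1+n n)))

  module _ (k-1 n-1 : ℕ) (μ : List ℕ) (μ>0 : All NonZero μ) where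

    private
      k = suc k-1
      n = suc n-1
      l = length μ
      s = sum μ

    -- The endpoint lies on y = kn, which has index 1, with d = n - s and e = 0. If s > n there are
    -- no paths and both binomials vanish.
    ends-count : Counts (Ends k n (k * n) μ) (n * multFact μ)
      ((n C suc s) * fall (suc (k * n)) l + (suc n C suc s) * (s * fall (k * n) (pred l)))
    ends-count = [ possible , impossible ]′ (≤-<-connex s n)
      where
      T = fall (suc (k * n)) l
      U = s * fall (k * n) (pred l)
      possible : s ≤ n → Counts (Ends k n (k * n) μ) (n * multFact μ) ((n C suc s) * T + (suc n C suc s) * U)
      possible s≤n = counts-subst
        (cong₂ (λ a b → a * T + b) (C⁻-complement s≤n)
          (cong₂ _*_ (sym (nCk≡nC[n∸k] (s≤s s≤n))) (+-identityʳ U)))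
        (subst (λ x → Counts (Ends k x (k * n) μ) (n * multFact μ) (levelTotal n (k * n) 1 (n ∸ s) l s 0))
          (m∸n+n≡m s≤n)
          (within-blocks k-1 n (block-count k-1 n-1) 0 (s≤s z≤n) (n ∸ s) 0 μ μ>0
            (≡.trans (+-identityʳ (n ∸ s + s)) (m∸n+n≡m s≤n))))
      impossible : n < s → Counts (Ends k n (k * n) μ) (n * multFact μ) ((n C suc s) * T + (suc n C suc s) * U)
      impossible n<s = counts-subst
        (sym (cong₂ (λ a b → a * T + b * U) (k>n⇒nCk≡0 (m≤n⇒m≤1+n n<s)) (k>n⇒nCk≡0 (s≤s n<s))))
        (counts-∅ (λ w ends → <⇒≱ n<s (ends-sum≤ k ends)))

    -- Here x = n - 1 on the line y = kn - 1, so d = n - 1 - s and e = 1.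
    diagonalEnds-count : ∀ {y} → suc y ≡ k * n →
      Counts (Ends k n-1 y μ) (n * multFact μ) ((n C suc s) * fall (k * n) l)
    diagonalEnds-count {y} y≡ = [ possible , impossible ]′ (≤-<-connex s n-1)
      where
      T = fall (k * n) l
      possible : s ≤ n-1 → Counts (Ends k n-1 y μ) (n * multFact μ) ((n C suc s) * T)
      possible s≤n = counts-subst
        (cong₂ _*_ (sym (nCk≡nC[n∸k] (s≤s s≤n))) (+-identityʳ T))
        (subst (λ x → Counts (Ends k x y μ) (n * multFact μ) ((n C (n-1 ∸ s)) * (1 * T))) (m∸n+n≡m s≤n)
          (block-count k-1 n-1 y≡ (n-1 ∸ s) 1 μ μ>0
            (≡.trans (cong (_+ 1) (m∸n+n≡m s≤n)) (+-comm n-1 1))))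
      impossible : n-1 < s → Counts (Ends k n-1 y μ) (n * multFact μ) ((n C suc s) * T)
      impossible n≤s = counts-subst (sym (cong (_* T) (k>n⇒nCk≡0 (s≤s n≤s))))
        (counts-∅ (λ w ends → <⇒≱ n≤s (ends-sum≤ k ends)))

  -- Multiplying by kn + 1 turns the `fall (k * n) (pred l)` of `ends-count` into
  -- `fall (suc (k * n)) l`, a common factor of both terms. Hence the denominator kn + 1 in the
  -- formula.
  large-paths : (k n : ℕ) .{{_ : NonZero k}} .{{_ : NonZero n}} (μ : Partition) → let K = suc (k * n) in
    ∃[ c ] HasCardinality (λ w → LargePath k n w × HasType w μ) c ×
    K * (n * multFactorial μ * c)
      ≡ (K * (n C suc ∥ μ ∥) + ∥ μ ∥ * (suc n C suc ∥ μ ∥)) * ((K C ℓ μ) * ℓ μ !)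
  large-paths k@(suc k-1) n@(suc n-1) μ =
    c ,
    card-cong (λ w → ⇔-sym (path⇔ends k (parts μ) w)) (card-image reverse-injective cardinality) ,
    (begin
      K * (n * multFactorial μ * c)         ≡⟨ cong (λ M → K * (n * M * c)) (multFactorial≡multFact μ) ⟩
      K * (n * multFact (parts μ) * c)      ≡⟨ cong (K *_) scaled ⟩
      K * (a * T + b * (s * U))             ≡⟨ distribute K a T b (s * U) ⟩
      K * a * T + b * (K * (s * U))
        ≡⟨ cong (λ t → K * a * T + b * t) (fall-shrink (k * n) (ℓ μ) s (length≡0⇒sum≡0 (parts μ))) ⟩
      K * a * T + b * (s * T)               ≡⟨ factor K a T b s ⟩
      (K * a + s * b) * T                   ∎)
    where
    open Counts (ends-count k-1 n-1 (parts μ) (positive μ)) renaming (number to c)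
    K = suc (k * n)
    s = ∥ μ ∥
    a = n C suc s
    b = suc n C suc s
    T = fall K (ℓ μ)
    U = fall (k * n) (pred (ℓ μ))
    distribute : ∀ K a T b U → K * (a * T + b * U) ≡ K * a * T + b * (K * U)
    distribute = solve-∀
    factor : ∀ K a T b s → K * a * T + b * (s * T) ≡ (K * a + s * b) * T
    factor = solve-∀

  large-paths-diagonal : (k n : ℕ) .{{_ : NonZero k}} .{{_ : NonZero n}} (μ : Partition) →
    ∃[ c ] HasCardinality (λ w → LargePath k n w × HasType w μ × last w ≡ just D) c ×
    n * multFactorial μ * c ≡ (n C suc ∥ μ ∥) * (((k * n) C ℓ μ) * ℓ μ !)
  large-paths-diagonal k@(suc k-1) n@(suc n-1) μ =
    c ,
    card-cong (λ w → ⇔-sym (diagonalPath⇔ends k (parts μ) refl w))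
      (card-image (∷-injectiveʳ ∘ reverse-injective) cardinality) ,
    ≡.trans (cong (λ M → n * M * c) (multFactorial≡multFact μ)) scaled
    where
    open Counts (diagonalEnds-count k-1 n-1 (parts μ) (positive μ) refl) renaming (number to c)

-- Passage to the rational numbers

open import Data.Integer.Base as ℤ using (+_)
import Data.Integer.Properties as ℤ
open import Data.Integer.Tactic.RingSolver using () renaming (solve-∀ to ℤ-solve-∀)
open import Data.Rational.Base using (ℚ; 1ℚ; _/_; _+_; _*_; fromℚᵘ)
open import Data.Rational.Properties
import Data.Rational.Solver as ℚ
open import Data.Rational.Unnormalised.Base as ℚᵘ using (mkℚᵘ; *≡*)
import Data.Rational.Unnormalised.Properties as ℚᵘ

-- By definition `fromℚᵘ (mkℚᵘ (+ a) n)` is `+ a / suc n`, so identities between fractions can be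
-- checked by cross-multiplication, without computing a gcd.
fromℚᵘ-homo-+ : ∀ p q → fromℚᵘ (p ℚᵘ.+ q) ≡ fromℚᵘ p + fromℚᵘ q
fromℚᵘ-homo-+ p q = toℚᵘ-injective (ℚᵘ.≃-trans (toℚᵘ-fromℚᵘ (p ℚᵘ.+ q)) (ℚᵘ.≃-sym
  (ℚᵘ.≃-trans (toℚᵘ-homo-+ (fromℚᵘ p) (fromℚᵘ q)) (ℚᵘ.+-cong (toℚᵘ-fromℚᵘ p) (toℚᵘ-fromℚᵘ q)))))

fromℚᵘ-homo-* : ∀ p q → fromℚᵘ (p ℚᵘ.* q) ≡ fromℚᵘ p * fromℚᵘ q
fromℚᵘ-homo-* p q = toℚᵘ-injective (ℚᵘ.≃-trans (toℚᵘ-fromℚᵘ (p ℚᵘ.* q)) (ℚᵘ.≃-sym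
  (ℚᵘ.≃-trans (toℚᵘ-homo-* (fromℚᵘ p) (fromℚᵘ q)) (ℚᵘ.*-cong (toℚᵘ-fromℚᵘ p) (toℚᵘ-fromℚᵘ q)))))

fromℕ-+ : ∀ a b → fromℕ (a ℕ.+ b) ≡ fromℕ a + fromℕ b
fromℕ-+ a b = ≡.trans (fromℚᵘ-cong {mkℚᵘ (+ (a ℕ.+ b)) 0} {mkℚᵘ (+ a) 0 ℚᵘ.+ mkℚᵘ (+ b) 0}
                      (*≡* (cong (ℤ._* + 1) (eq (+ a) (+ b)))))
                    (fromℚᵘ-homo-+ (mkℚᵘ (+ a) 0) (mkℚᵘ (+ b) 0))
  where
  eq : ∀ a b → a ℤ.+ b ≡ a ℤ.* + 1 ℤ.+ b ℤ.* + 1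
  eq = ℤ-solve-∀

fromℕ-* : ∀ a b → fromℕ (a ℕ.* b) ≡ fromℕ a * fromℕ b
fromℕ-* a b = ≡.trans (fromℚᵘ-cong {mkℚᵘ (+ (a ℕ.* b)) 0} {mkℚᵘ (+ a) 0 ℚᵘ.* mkℚᵘ (+ b) 0}
                      (*≡* (cong (ℤ._* + 1) (ℤ.pos-* a b))))
                    (fromℚᵘ-homo-* (mkℚᵘ (+ a) 0) (mkℚᵘ (+ b) 0))

fraction : ∀ a n .{{_ : NonZero n}} → + a / n ≡ fromℕ a * (+ 1 / n)
fraction a (suc n) = ≡.trans (fromℚᵘ-cong {mkℚᵘ (+ a) n} {mkℚᵘ (+ a) 0 ℚᵘ.* mkℚᵘ (+ 1) n}
                      (*≡* (cong₂ ℤ._*_ (sym (ℤ.*-identityʳ (+ a))) (cong +_ (ℕ.+-identityʳ (suc n))))))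
                    (fromℚᵘ-homo-* (mkℚᵘ (+ a) 0) (mkℚᵘ (+ 1) n))

reciprocal : ∀ n .{{_ : NonZero n}} → fromℕ n * (+ 1 / n) ≡ 1ℚ
reciprocal (suc n) = ≡.trans (sym (fraction (suc n) (suc n)))
  (fromℚᵘ-cong {mkℚᵘ (+ suc n) n} {ℚᵘ.1ℚᵘ} (*≡* (ℤ.*-comm (+ suc n) (+ 1))))

-- Both formulas have this shape, the second one with the term in `B` equal to zero.
solve-for-count : ∀ n K M c A s B Y L .{{_ : NonZero n}} .{{_ : NonZero K}} .{{_ : NonZero M}} →
  K ℕ.* (n ℕ.* M ℕ.* c) ≡ (K ℕ.* A ℕ.+ s ℕ.* B) ℕ.* (Y ℕ.* L) →
  fromℕ c ≡ (+ 1 / n) * (fromℕ A + (+ s / K) * fromℕ B) * fromℕ Y * (+ L / M)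
solve-for-count n K M c A s B Y L eq = begin
  x                                       ≡⟨ pad x ⟩
  x * (1ℚ * 1ℚ * 1ℚ)
    -- Each 1 becomes a denominator times its reciprocal; the denominators are then absorbed by
    -- `eq`.
    ≡⟨ cong (x *_) (cong₂ _*_ (cong₂ _*_ (reciprocal n) (reciprocal K)) (reciprocal M)) ⟨
  x * (φ n * n⁻¹ * (φ K * K⁻¹) * (φ M * M⁻¹))
    ≡⟨ shuffle x (φ n) n⁻¹ (φ K) K⁻¹ (φ M) M⁻¹ ⟩
  φ K * (φ n * φ M * x) * (n⁻¹ * K⁻¹ * M⁻¹)
    ≡⟨ cong (_* (n⁻¹ * K⁻¹ * M⁻¹)) homo ⟩
  (φ K * φ A + φ s * φ B) * (φ Y * φ L) * (n⁻¹ * K⁻¹ * M⁻¹)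
    ≡⟨ split (φ K) (φ A) (φ s) (φ B) (φ Y) (φ L) n⁻¹ K⁻¹ M⁻¹ ⟩
  n⁻¹ * ((φ K * K⁻¹) * φ A + (φ s * K⁻¹) * φ B) * φ Y * (φ L * M⁻¹)
    ≡⟨ cong (λ t → n⁻¹ * (t * φ A + (φ s * K⁻¹) * φ B) * φ Y * (φ L * M⁻¹)) (reciprocal K) ⟩
  n⁻¹ * (1ℚ * φ A + (φ s * K⁻¹) * φ B) * φ Y * (φ L * M⁻¹)
    ≡⟨ cong (λ t → n⁻¹ * (t + (φ s * K⁻¹) * φ B) * φ Y * (φ L * M⁻¹)) (*-identityˡ (φ A)) ⟩
  n⁻¹ * (φ A + (φ s * K⁻¹) * φ B) * φ Y * (φ L * M⁻¹)
    ≡⟨ cong₂ (λ t u → n⁻¹ * (φ A + t * φ B) * φ Y * u) (fraction s K) (fraction L M) ⟨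
  n⁻¹ * (φ A + (+ s / K) * φ B) * φ Y * (+ L / M) ∎
  where
  open ℚ.+-*-Solver
  φ = fromℕ
  x = φ c
  n⁻¹ = + 1 / n
  K⁻¹ = + 1 / K
  M⁻¹ = + 1 / M
  homo : φ K * (φ n * φ M * x) ≡ (φ K * φ A + φ s * φ B) * (φ Y * φ L)
  homo = begin
    φ K * (φ n * φ M * x)                     ≡⟨ cong (λ t → φ K * (t * x)) (fromℕ-* n M) ⟨
    φ K * (φ (n ℕ.* M) * x)                   ≡⟨ cong (φ K *_) (fromℕ-* (n ℕ.* M) c) ⟨
    φ K * φ (n ℕ.* M ℕ.* c)                   ≡⟨ fromℕ-* K (n ℕ.* M ℕ.* c) ⟨
    φ (K ℕ.* (n ℕ.* M ℕ.* c))                 ≡⟨ cong φ eq ⟩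
    φ ((K ℕ.* A ℕ.+ s ℕ.* B) ℕ.* (Y ℕ.* L))   ≡⟨ fromℕ-* (K ℕ.* A ℕ.+ s ℕ.* B) (Y ℕ.* L) ⟩
    φ (K ℕ.* A ℕ.+ s ℕ.* B) * φ (Y ℕ.* L)     ≡⟨ cong₂ _*_ (fromℕ-+ (K ℕ.* A) (s ℕ.* B)) (fromℕ-* Y L) ⟩
    (φ (K ℕ.* A) + φ (s ℕ.* B)) * (φ Y * φ L)
      ≡⟨ cong (_* (φ Y * φ L)) (cong₂ _+_ (fromℕ-* K A) (fromℕ-* s B)) ⟩
    (φ K * φ A + φ s * φ B) * (φ Y * φ L)     ∎
  pad : ∀ c → c ≡ c * (1ℚ * 1ℚ * 1ℚ)
  pad c = sym (*-identityʳ c)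
  shuffle : ∀ c n n⁻¹ k k⁻¹ m m⁻¹ →
    c * (n * n⁻¹ * (k * k⁻¹) * (m * m⁻¹)) ≡ k * (n * m * c) * (n⁻¹ * k⁻¹ * m⁻¹)
  shuffle = solve 7 (λ c n n⁻¹ k k⁻¹ m m⁻¹ →
    c :* (n :* n⁻¹ :* (k :* k⁻¹) :* (m :* m⁻¹)) := k :* (n :* m :* c) :* (n⁻¹ :* k⁻¹ :* m⁻¹)) refl
  split : ∀ k a s b y l n⁻¹ k⁻¹ m⁻¹ →
    (k * a + s * b) * (y * l) * (n⁻¹ * k⁻¹ * m⁻¹)
    ≡ n⁻¹ * ((k * k⁻¹) * a + (s * k⁻¹) * b) * y * (l * m⁻¹)
  split = solve 9 (λ k a s b y l n⁻¹ k⁻¹ m⁻¹ →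
    (k :* a :+ s :* b) :* (y :* l) :* (n⁻¹ :* k⁻¹ :* m⁻¹)
    := n⁻¹ :* ((k :* k⁻¹) :* a :+ (s :* k⁻¹) :* b) :* y :* (l :* m⁻¹)) refl

mainTheorem1 : (k n : ℕ) .{{_ : NonZero k}} .{{_ : NonZero n}} (μ : Partition) →
    (∃[ c ]
    HasCardinality (λ w → LargePath k n w × HasType w μ) c ×
    fromℕ c ≡
    (+ 1 / n)
    * (fromℕ (n C suc ∥ μ ∥) + (+ ∥ μ ∥ / suc (k *ℕ n)) * fromℕ (suc n C suc ∥ μ ∥))
    * fromℕ (suc (k *ℕ n) C ℓ μ)
    * (+ (ℓ μ !) / multFactorial μ) {{multFactorial≢0 μ}})
    ×
    (∃[ c ]
    HasCardinality (λ w → LargePath k n w × HasType w μ × last w ≡ just D) c ×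
    fromℕ c ≡
    (+ 1 / n)
    * fromℕ (n C suc ∥ μ ∥)
    * fromℕ ((k *ℕ n) C ℓ μ)
    * (+ (ℓ μ !) / multFactorial μ) {{multFactorial≢0 μ}})
mainTheorem1 k n μ =
  let c₁ , card₁ , eq₁ = large-paths k n μ
      c₂ , card₂ , eq₂ = large-paths-diagonal k n μ in
  (c₁ , card₁ ,
    solve-for-count n K (multFactorial μ) c₁ a ∥ μ ∥ (suc n C suc ∥ μ ∥) (K C ℓ μ) (ℓ μ !) eq₁) ,
  (c₂ , card₂ , ≡.trans
    -- With `K` = 1 and 0 for `s` and `B`, the second summand evaluates to 0 and `+-identityʳ`
    -- removes it.
    (solve-for-count n 1 (multFactorial μ) c₂ a 0 0 Y (ℓ μ !) (begin
      1 *ℕ (n *ℕ multFactorial μ *ℕ c₂)    ≡⟨ ℕ.*-identityˡ (n *ℕ multFactorial μ *ℕ c₂) ⟩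
      n *ℕ multFactorial μ *ℕ c₂           ≡⟨ eq₂ ⟩
      a *ℕ (Y *ℕ ℓ μ !)
        ≡⟨ cong (_*ℕ (Y *ℕ ℓ μ !)) (≡.trans (ℕ.+-identityʳ (1 *ℕ a)) (ℕ.*-identityˡ a)) ⟨
      (1 *ℕ a ℕ.+ 0) *ℕ (Y *ℕ ℓ μ !)       ∎))
    (cong (λ t → (+ 1 / n) * t * fromℕ Y * (+ (ℓ μ !) / multFactorial μ)) (+-identityʳ (fromℕ a))))
  where
  instance _ = multFactorial≢0 μ
  K = suc (k *ℕ n)
  a = n C suc ∥ μ ∥
  Y = (k *ℕ n) C ℓ μ
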